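{- For each integer $n\ge 0$, let $a_n$ denote the number of tilings of a $5\times 8n$ board by $L$-tetrominoes (rotations allowed, reflections not allowed). Then the generating function is \[ \sum_{n\geq 0}a_nt^n= \frac{2 t^{4}+2 t^{3}+t^{2}-1}{4 t^{4}+4 t^{3}+4 t^{2}+2 t -1}.\] Consequently, \[a_n=2a_{n-1}+4a_{n-2}+4a_{n-3}+4a_{n-4}\quad\text{for all } n\geq 5,\] with initial values $a_0=1$, $a_1=2$, $a_2=7$, $a_3=24$, $a_4=86$. The first terms of the sequence $(a_n)_{n\ge 0}$ are $1,2,7,24,86,304,1076,3808,\ldots$
   Context: A $k\times n$ board is the rectangle of unit cells $\{(x,y)\in\mathbb{Z}^2: 0\le x<n,\ 0\le y<k\}$, where each cell is named by its bottom left corner. The $L$-tetromino tiles are the translates of the four sets (the rotations of the $L$-tetromino) \[\{(0,0),(0,1),(0,2),(1,0)\},\ \{(0,0),(0,1),(1,1),(2,1)\},\ \{(0,0),(1,0),(2,0),(2,1)\},\ \{(0,2),(1,0),(1,1),(1,2)\}.\] Reflections of these shapes are not allowed. A tiling of a board is a partition of its set of cells into such tiles (each tile may be used any number of times); two tilings are the same only if they are equal as partitions of the board (no identification under symmetries). The empty board ($n=0$) has exactly one tiling. Generating functions are formal power series in $t$ with rational coefficients. -}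

module Defs where

open import Data.Fin.Base using (Fin)
open import Data.Fin.Permutation using (↔⇒≡)
open import Data.Integer.Base as ℤ using (ℤ; +_; 0ℤ)
open import Data.List.Base using (List; []; _∷_; map)
open import Data.List.Membership.Propositional using (_∈_)
open import Data.Nat.Base using (ℕ; zero; suc)
open import Data.Product.Base using (_×_; _,_; ∃-syntax)
open import Data.Rational.Base using (ℚ; 0ℚ; 1ℚ; -_; _+_; _-_; _*_; _÷_; 1/_; NonZero; _/_)
open import Data.Rational.Properties
open import Function.Bundles using (Inverse)
open import Function.Construct.Composition using (inverse)
open import Function.Construct.Symmetry using () renaming (inverse to inverse-sym)
open import Level using (0ℓ) renaming (suc to lsuc)
open import Relation.Binary.Bundles using (Setoid)
open import Relation.Binary.Definitions using (_Respects_)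
open import Relation.Binary.PropositionalEquality
open import Relation.Unary using (Pred; _⊆_; _≐_; _≬_)
open import Relation.Unary.Properties using (≐-refl; ≐-sym; ≐-trans)

Cell : Set
Cell = ℤ × ℤ

CellSet : Set₁
CellSet = Pred Cell 0ℓ

Board : (k n : ℕ) → CellSet
Board k n (x , y) = (0ℤ ℤ.≤ x × x ℤ.< + n) × (0ℤ ℤ.≤ y × y ℤ.< + k)

shapes : List (List Cell)
shapes =
    ((+ 0 , + 0) ∷ (+ 0 , + 1) ∷ (+ 0 , + 2) ∷ (+ 1 , + 0) ∷ [])
  ∷ ((+ 0 , + 0) ∷ (+ 0 , + 1) ∷ (+ 1 , + 1) ∷ (+ 2 , + 1) ∷ [])
  ∷ ((+ 0 , + 0) ∷ (+ 1 , + 0) ∷ (+ 2 , + 0) ∷ (+ 2 , + 1) ∷ [])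
  ∷ ((+ 0 , + 2) ∷ (+ 1 , + 0) ∷ (+ 1 , + 1) ∷ (+ 1 , + 2) ∷ [])
  ∷ []

shift : Cell → Cell → Cell
shift (u , v) (x , y) = u ℤ.+ x , v ℤ.+ y

translate : Cell → List Cell → CellSet
translate v shape c = c ∈ map (shift v) shape

IsTile : CellSet → Set
IsTile s = ∃[ shape ] ∃[ v ] shape ∈ shapes × s ≐ translate v shape

-- A partition is a set of cell sets, i.e. a predicate on cell sets that respects
-- extensional equality. Blocks are automatically nonempty, being tiles.
record Tiling (B : CellSet) : Set₁ where
  field
    Block      : Pred CellSet 0ℓ
    respects   : Block Respects _≐_
    tiles      : ∀ {s} → Block s → IsTile s
    inside     : ∀ {s} → Block s → s ⊆ B
    covers     : ∀ {c} → B c → ∃[ s ] Block s × s c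
    disjoint   : ∀ {s s′} → Block s → Block s′ → s ≬ s′ → s ≐ s′

open Tiling

Tilings : CellSet → Setoid (lsuc 0ℓ) (lsuc 0ℓ)
Tilings B = record
  { Carrier       = Tiling B
  ; _≈_           = λ T T′ → Block T ≐ Block T′
  ; isEquivalence = record { refl = ≐-refl ; sym = ≐-sym ; trans = ≐-trans }
  }

HasCardinality : ∀ {a ℓ} → Setoid a ℓ → ℕ → Set _
HasCardinality S n = Inverse (setoid (Fin n)) S

HasCardinality-unique : ∀ {a ℓ} (S : Setoid a ℓ) {m n} →
                        HasCardinality S m → HasCardinality S n → m ≡ n
HasCardinality-unique S f g = ↔⇒≡ (inverse f (inverse-sym g))

-- A formal power series is its sequence of coefficients.
PowerSeries : Set
PowerSeries = ℕ → ℚ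

tail : PowerSeries → PowerSeries
tail f n = f (suc n)

polynomial : List ℚ → PowerSeries
polynomial []       _       = 0ℚ
polynomial (c ∷ _)  zero    = c
polynomial (_ ∷ cs) (suc n) = polynomial cs n

generatingFunction : (ℕ → ℕ) → PowerSeries
generatingFunction a n = + a n / 1

infixl 7 _⊛_ _⊘_

-- With f = f₀ + t f′, the Cauchy product satisfies f g = f₀ g + t (f′ g).
_⊛_ : PowerSeries → PowerSeries → PowerSeries
(f ⊛ g) zero    = f 0 * g 0
(f ⊛ g) (suc n) = f 0 * g (suc n) + (tail f ⊛ g) n

-- Division by a series with nonzero constant term, by long division: with
-- c = f₀ / g₀, the series f - c g is divisible by t and f / g = c + t (((f - c g) / t) / g).
_⊘_ : (f g : PowerSeries) → .{{NonZero (g 0)}} → PowerSeries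
(f ⊘ g) zero    = f 0 ÷ g 0
(f ⊘ g) (suc n) = ((λ m → f (suc m) - (f 0 ÷ g 0) * g (suc m)) ⊘ g) n

⊘-⊛-cancel : ∀ f g .{{_ : NonZero (g 0)}} → (f ⊘ g) ⊛ g ≗ f
⊘-⊛-cancel f g zero = begin
  f 0 * 1/ (g 0) * g 0    ≡⟨ *-assoc (f 0) (1/ (g 0)) (g 0) ⟩
  f 0 * (1/ (g 0) * g 0)  ≡⟨ cong (f 0 *_) (*-inverseˡ (g 0)) ⟩
  f 0 * 1ℚ              ≡⟨ *-identityʳ (f 0) ⟩
  f 0                     ∎
  where open ≡-Reasoning
⊘-⊛-cancel f g (suc n) = begin
  p + (r ⊘ g ⊛ g) n                   ≡⟨ cong (λ q → p + q) (⊘-⊛-cancel r g n) ⟩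
  p + (f (suc n) - p)                 ≡⟨ +-comm p (f (suc n) - p) ⟩
  f (suc n) - p + p                   ≡⟨ +-assoc (f (suc n)) (- p) p ⟩
  f (suc n) + (- p + p)               ≡⟨ cong (λ q → f (suc n) + q) (+-inverseˡ p) ⟩
  f (suc n) + 0ℚ                      ≡⟨ +-identityʳ (f (suc n)) ⟩
  f (suc n)                           ∎
  where
  open ≡-Reasoning
  p : ℚ
  p = (f 0 ÷ g 0) * g (suc n)
  r : PowerSeries
  r m = f (suc m) - (f 0 ÷ g 0) * g (suc m)

-- Coefficients in increasing degree: 2t⁴ + 2t³ + t² - 1 and 4t⁴ + 4t³ + 4t² + 2t - 1.
numerator denominator : PowerSeries
numerator   = polynomial (ℤ.-1ℤ / 1 ∷ + 0 / 1 ∷ + 1 / 1 ∷ + 2 / 1 ∷ + 2 / 1 ∷ [])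
denominator = polynomial (ℤ.-1ℤ / 1 ∷ + 2 / 1 ∷ + 4 / 1 ∷ + 4 / 1 ∷ + 4 / 1 ∷ [])

{-# OPTIONS --safe #-}
module Submission where

-- Two tilings agree as soon as the block through a given cell agrees and the rest does, so the
-- number of tilings of a region is a sum over the tiles through its first cell. Iterating this
-- on the first eight columns of a 5 × 8(n+1) board is a finite computation: only nine boundary
-- shapes occur, three of which admit no completion, so the numbers of completions of the
-- shapes satisfy a linear system. Eliminating all of them but that of the straight boundary
-- gives the recurrence, by which long division by the denominator returns the sequence.

open import Defs
open Tiling

open import Data.Empty using (⊥)
open import Data.Fin.Base using (Fin; zero; suc)
open import Data.Integer.Base as ℤ using (ℤ; +_; -_; 0ℤ)
import Data.Integer.Properties as ℤ
open import Data.List.Base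
  using (List; []; _∷_; _++_; map; filter; concatMap; upTo; replicate; length; lookup)
open import Data.List.Membership.Propositional using (_∈_; _∉_; find; lose)
open import Data.List.Membership.Propositional.Properties
import Data.List.Membership.DecPropositional as DecMembership
import Data.List.Membership.Setoid as SetoidMembership
import Data.List.Membership.Setoid.Properties as SetoidMembershipₚ
import Data.List.Properties as List
open import Data.List.Relation.Unary.All as All using (All; []; _∷_; all?)
import Data.List.Relation.Unary.All.Properties as All
open import Data.List.Relation.Unary.AllPairs as AllPairs using (AllPairs; []; _∷_; allPairs?)
import Data.List.Relation.Unary.AllPairs.Properties as AllPairs
open import Data.List.Relation.Unary.Any using (Any; here; there; index)
import Data.List.Relation.Unary.Any.Properties as Any
import Data.List.Relation.Unary.Unique.Setoid as Unique
import Data.List.Relation.Unary.Unique.Setoid.Properties as Unique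
open import Data.Nat.Base using (ℕ; zero; suc; _+_; _*_; _∸_; _≥_; _≤_; _<_; z≤n; s≤s)
open import Data.Nat.ListAction using (sum)
import Data.Nat.Properties as ℕ
open import Data.Nat.Tactic.RingSolver using (solve-∀)
open import Data.Product.Base using (_×_; ∃-syntax; _,_; proj₁; proj₂)
open import Data.Product.Properties using (≡-dec)
open import Data.Rational.Base as ℚ using (ℚ; 0ℚ; _/_)
  renaming (_+_ to _+ℚ_; _*_ to _*ℚ_; _-_ to _-ℚ_; -_ to -ℚ_)
import Data.Rational.Properties as ℚ
open import Data.Rational.Solver using (module +-*-Solver)
import Data.Rational.Unnormalised.Base as ℚᵘ
import Data.Rational.Unnormalised.Properties as ℚᵘ
open import Data.Sum.Base as Sum using (_⊎_; inj₁; inj₂; [_,_]′)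
open import Function.Base using (_∘_; id)
open import Function.Definitions using (Congruent; Injective)
open import Level using (Level; 0ℓ; _⊔_)
open import Relation.Binary.Bundles using (Setoid)
open import Relation.Binary.Definitions using (DecidableEquality; _Respects_)
open import Relation.Binary.PropositionalEquality as ≡ using (_≡_; refl; _≗_)
open import Relation.Nullary using (¬_; Dec; yes; no; contradiction; ¬?)
open import Relation.Nullary.Decidable using (from-yes)
open import Relation.Unary using (Pred; _⊆_; _≐_; _≬_; _∪_; U)
open import Relation.Unary.Properties using (≐-sym; ≐-trans)

-- Finite enumerations of setoids.

private
  variable
    a b ℓ ℓ′ p q : Level

-- Relative to a predicate, so that the tilings of one region can be split by the block through a
-- cell and the counts added.
record Enumeration (S : Setoid a ℓ) (P : Pred (Setoid.Carrier S) p) (n : ℕ) : Set (a ⊔ ℓ ⊔ p) where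
  field
    elements : List (Setoid.Carrier S)
    size     : length elements ≡ n
    sound    : All P elements
    unique   : Unique.Unique S elements
    complete : ∀ {x} → P x → SetoidMembership._∈_ S x elements

open Enumeration

module _ (S : Setoid a ℓ) where
  open Setoid S using (Carrier; _≈_; sym; trans)

  lookup-injective : ∀ {xs} → Unique.Unique S xs → ∀ i j → lookup xs i ≈ lookup xs j → i ≡ j
  lookup-injective (_ ∷ _)      zero    zero    _  = refl
  lookup-injective (x∉xs ∷ _)   zero    (suc j) eq = contradiction eq (All.lookup x∉xs (∈-lookup j))
  lookup-injective (x∉xs ∷ _)   (suc i) zero    eq = contradiction (sym eq) (All.lookup x∉xs (∈-lookup i))
  lookup-injective (_ ∷ unique) (suc i) (suc j) eq = ≡.cong suc (lookup-injective unique i j eq)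

  enumeration⇒cardinality : ∀ {n} → Enumeration S U n → HasCardinality S n
  enumeration⇒cardinality e = ≡.subst (HasCardinality S) (size e) record
    { to        = lookup (elements e)
    ; from      = position
    ; to-cong   = λ { refl → Setoid.refl S }
    ; from-cong = λ {x} {y} x≈y → lookup-injective (unique e) _ _
                    (trans (sym (at-position x)) (trans x≈y (at-position y)))
    ; inverse   = (λ { {x} refl → sym (at-position x) })
                , (λ {i} {x} x≈ → lookup-injective (unique e) _ _ (trans (sym (at-position x)) x≈))
    }
    where
    position : Carrier → Fin (length (elements e))
    position x = index (complete e {x} _)
    at-position : ∀ x → x ≈ lookup (elements e) (position x)
    at-position x = Any.lookup-index (complete e {x} _)

  -- Exclusion is asked across equivalent elements because nothing makes `P` and `Q` respect `_≈_`.
  enumeration-∪ : ∀ {P : Pred Carrier p} {Q : Pred Carrier q} {m n} →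
                  (∀ {x y} → x ≈ y → P x → Q y → ⊥) →
                  Enumeration S P m → Enumeration S Q n → Enumeration S (P ∪ Q) (m + n)
  enumeration-∪ {P = P} {Q} disj d e = record
    { elements = elements d ++ elements e
    ; size     = ≡.trans (List.length-++ (elements d)) (≡.cong₂ _+_ (size d) (size e))
    ; sound    = All.++⁺ (All.map inj₁ (sound d)) (All.map inj₂ (sound e))
    ; unique   = Unique.++⁺ S (unique d) (unique e) λ (x∈d , x∈e) →
        let Py , x≈y = All.lookupAny (sound d) x∈d
            Qz , x≈z = All.lookupAny (sound e) x∈e
        in disj (trans (sym x≈y) x≈z) Py Qz
    ; complete = [ SetoidMembershipₚ.∈-++⁺ˡ S ∘ complete d
                 , SetoidMembershipₚ.∈-++⁺ʳ S (elements d) ∘ complete e ]′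
    }

  enumeration-∅ : ∀ {P : Pred Carrier p} → (∀ {x} → ¬ P x) → Enumeration S P 0
  enumeration-∅ empty = record
    { elements = [] ; size = refl ; sound = [] ; unique = []
    ; complete = λ Px → contradiction Px empty }

  enumeration-resp : ∀ {P : Pred Carrier p} {Q : Pred Carrier q} {n} → P ≐ Q →
                     Enumeration S P n → Enumeration S Q n
  enumeration-resp (P⊆Q , Q⊆P) e = record
    { elements = elements e ; size = size e ; sound = All.map P⊆Q (sound e)
    ; unique = unique e ; complete = complete e ∘ Q⊆P }

module _ (S : Setoid a ℓ) (T : Setoid b ℓ′) where
  open Setoid S using () renaming (Carrier to A; _≈_ to _≈₁_)
  open Setoid T using () renaming (Carrier to B; _≈_ to _≈₂_)

  enumeration-image : ∀ {P : Pred B p} {n} (f : A → B) →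
    Congruent _≈₁_ _≈₂_ f → Injective _≈₁_ _≈₂_ f → (∀ x → P (f x)) →
    (∀ {y} → P y → ∃[ x ] y ≈₂ f x) →
    Enumeration S U n → Enumeration T P n
  enumeration-image f f-cong f-inj P-f onto e = record
    { elements = map f (elements e)
    ; size     = ≡.trans (List.length-map f (elements e)) (size e)
    ; sound    = All.map⁺ (All.universal P-f (elements e))
    ; unique   = Unique.map⁺ S T f-inj (unique e)
    ; complete = λ Py → let x , y≈fx = onto Py in
        SetoidMembershipₚ.∈-resp-≈ T (Setoid.sym T y≈fx)
          (SetoidMembershipₚ.∈-map⁺ S T f-cong (complete e {x} _))
    }

-- Tilings that contain a given tile.

Count : CellSet → ℕ → Set₁
Count R n = Enumeration (Tilings R) U n

⟪_⟫ : List Cell → CellSet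
⟪ t ⟫ c = c ∈ t

_∖_ : CellSet → List Cell → CellSet
(R ∖ t) c = R c × c ∉ t

_≟ᶜ_ : DecidableEquality Cell
_≟ᶜ_ = ≡-dec ℤ._≟_ ℤ._≟_

open DecMembership _≟ᶜ_ using (_∈?_; _∉?_)

include : ∀ {R R′} → R ⊆ R′ → R′ ⊆ R → Tiling R → Tiling R′
include R⊆R′ R′⊆R T = record
  { Block = Block T ; respects = respects T ; tiles = tiles T
  ; inside = λ s∈T → R⊆R′ ∘ inside T s∈T ; covers = covers T ∘ R′⊆R ; disjoint = disjoint T }

count-resp : ∀ {R R′ n} → R ≐ R′ → Count R n → Count R′ n
count-resp (R⊆R′ , R′⊆R) = enumeration-image _ _ (include R⊆R′ R′⊆R) id id _
  (λ {T} _ → include R′⊆R R⊆R′ T , id , id)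

tile-resp : IsTile Respects _≐_
tile-resp s≐s′ (shape , v , shape∈ , s≐) = shape , v , shape∈ , ≐-trans (≐-sym s≐s′) s≐

nonempty : All (λ shape → ∃[ o ] o ∈ shape) shapes
nonempty = (_ , here refl) ∷ (_ , here refl) ∷ (_ , here refl) ∷ (_ , here refl) ∷ []

-- One cell is enough to compare a block with a given tile, since blocks sharing a cell coincide.
tile-cell : ∀ {s} → IsTile s → ∃[ c ] s c
tile-cell (shape , v , shape∈ , s≐) =
  _ , proj₂ s≐ (∈-map⁺ (shift v) (proj₂ (All.lookup nonempty shape∈)))

module _ {R : CellSet} {t : List Cell} (t-tile : IsTile ⟪ t ⟫) (t⊆R : ⟪ t ⟫ ⊆ R) where

  outside : ∀ {s} → IsTile s → s ⊆ R ∖ t → ¬ (s ≐ ⟪ t ⟫)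
  outside s-tile s⊆R∖t (s⊆t , _) =
    let c , c∈s = tile-cell s-tile in proj₂ (s⊆R∖t c∈s) (s⊆t c∈s)

  add : Tiling (R ∖ t) → Tiling R
  add T = record
    { Block    = λ s → Block T s ⊎ s ≐ ⟪ t ⟫
    ; respects = λ s≐s′ → Sum.map (respects T s≐s′) (≐-trans (≐-sym s≐s′))
    ; tiles    = [ tiles T , (λ s≐t → tile-resp (≐-sym s≐t) t-tile) ]′
    ; inside   = [ (λ s∈T → proj₁ ∘ inside T s∈T) , (λ (s⊆t , _) → t⊆R ∘ s⊆t) ]′
    ; covers   = covers′
    ; disjoint = disjoint′
    }
    where
    covers′ : ∀ {c} → R c → ∃[ s ] (Block T s ⊎ s ≐ ⟪ t ⟫) × s c
    covers′ {c} c∈R with c ∈? t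
    ... | yes c∈t = ⟪ t ⟫ , inj₂ (id , id) , c∈t
    ... | no  c∉t = let s , s∈T , c∈s = covers T (c∈R , c∉t) in s , inj₁ s∈T , c∈s
    disjoint′ : ∀ {s s′} → Block T s ⊎ s ≐ ⟪ t ⟫ → Block T s′ ⊎ s′ ≐ ⟪ t ⟫ → s ≬ s′ → s ≐ s′
    disjoint′ (inj₁ s∈T)       (inj₁ s′∈T)       s≬s′             = disjoint T s∈T s′∈T s≬s′
    disjoint′ (inj₁ s∈T)       (inj₂ (s′⊆t , _)) (c , c∈s , c∈s′) =
      contradiction (s′⊆t c∈s′) (proj₂ (inside T s∈T c∈s))
    disjoint′ (inj₂ (s⊆t , _)) (inj₁ s′∈T)       (c , c∈s , c∈s′) =
      contradiction (s⊆t c∈s) (proj₂ (inside T s′∈T c∈s′))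
    disjoint′ (inj₂ s≐t)       (inj₂ s′≐t)       _                = ≐-trans s≐t (≐-sym s′≐t)

  -- By disjointness the blocks contained in `R ∖ t` are exactly those different from `t`;
  -- containment is the form that yields `inside` at once.
  remove : ∀ T → Block T ⟪ t ⟫ → Tiling (R ∖ t)
  remove T t∈T = record
    { Block    = λ s → Block T s × s ⊆ R ∖ t
    ; respects = λ (s⊆s′ , s′⊆s) (s∈T , s⊆R∖t) → respects T (s⊆s′ , s′⊆s) s∈T , s⊆R∖t ∘ s′⊆s
    ; tiles    = tiles T ∘ proj₁
    ; inside   = proj₂
    ; covers   = λ (c∈R , c∉t) → let s , s∈T , c∈s = covers T c∈R in
        s , (s∈T , λ d∈s → inside T s∈T d∈s ,
                           λ d∈t → c∉t (proj₁ (disjoint T s∈T t∈T (_ , d∈s , d∈t)) c∈s)) , c∈s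
    ; disjoint = λ (s∈T , _) (s′∈T , _) → disjoint T s∈T s′∈T
    }

  -- Whether an arbitrary cell set equals `t` cannot be decided, but membership of one of its cells
  -- in the list `t` can. A shared cell forces equality by disjointness; otherwise the block avoids
  -- `t` altogether.
  add-remove : ∀ T (t∈T : Block T ⟪ t ⟫) → Block T ≐ Block (add (remove T t∈T))
  add-remove T t∈T = split , [ proj₁ , (λ s≐t → respects T (≐-sym s≐t) t∈T) ]′
    where
    split : Block T ⊆ Block (add (remove T t∈T))
    split {s} s∈T with c , c∈s ← tile-cell (tiles T s∈T) with c ∈? t
    ... | yes c∈t = inj₂ (disjoint T s∈T t∈T (c , c∈s , c∈t))
    ... | no  c∉t = inj₁ (s∈T , λ d∈s → inside T s∈T d∈s ,
                            λ d∈t → c∉t (proj₁ (disjoint T s∈T t∈T (_ , d∈s , d∈t)) c∈s))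

  add-injective : ∀ {T T′} → Block (add T) ≐ Block (add T′) → Block T ≐ Block T′
  add-injective {T} {T′} (T⊆T′ , T′⊆T) = reflect T T′ T⊆T′ , reflect T′ T T′⊆T
    where
    reflect : ∀ T T′ → Block (add T) ⊆ Block (add T′) → Block T ⊆ Block T′
    reflect T T′ T⊆T′ s∈T =
      [ id , (λ s≐t → contradiction s≐t (outside (tiles T s∈T) (inside T s∈T))) ]′ (T⊆T′ (inj₁ s∈T))

  count-with : ∀ {n} → Count (R ∖ t) n → Enumeration (Tilings R) (λ T → Block T ⟪ t ⟫) n
  count-with = enumeration-image _ _ add
    (λ (f , g) → Sum.map₁ f , Sum.map₁ g) (λ {T} {T′} → add-injective {T} {T′})
    (λ _ → inj₂ (id , id)) (λ {T} t∈T → remove T t∈T , add-remove T t∈T)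

-- Every tile has a cell, so the only tiling is the one without blocks.
count-∅ : ∀ {R : CellSet} → (∀ {c} → ¬ R c) → Count R 1
count-∅ {R} R-empty = record
  { elements = empty ∷ [] ; size = refl ; sound = _ ∷ [] ; unique = [] ∷ []
  ; complete = λ {T} _ → here ((λ s∈T → R-empty (inside T s∈T (proj₂ (tile-cell (tiles T s∈T))))) , λ ()) }
  where
  empty : Tiling R
  empty = record
    { Block = λ _ → ⊥ ; respects = λ _ () ; tiles = λ () ; inside = λ ()
    ; covers = λ c∈R → contradiction c∈R R-empty ; disjoint = λ () }

-- Translation invariance of the counts.

neg : Cell → Cell
neg (x , y) = - x , - y

shift-assoc : ∀ u v c → shift (shift u v) c ≡ shift u (shift v c)
shift-assoc (u , u′) (v , v′) (x , y) = ≡.cong₂ _,_ (ℤ.+-assoc u v x) (ℤ.+-assoc u′ v′ y)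

cancelʳ : ∀ i j → i ℤ.+ (- i ℤ.+ j) ≡ j
cancelʳ i j = ≡.trans (≡.sym (ℤ.+-assoc i (- i) j))
  (≡.trans (≡.cong (ℤ._+ j) (ℤ.+-inverseʳ i)) (ℤ.+-identityˡ j))

cancelˡ : ∀ i j → - i ℤ.+ (i ℤ.+ j) ≡ j
cancelˡ i j = ≡.trans (≡.sym (ℤ.+-assoc (- i) i j))
  (≡.trans (≡.cong (ℤ._+ j) (ℤ.+-inverseˡ i)) (ℤ.+-identityˡ j))

shift-neg : ∀ v c → shift v (shift (neg v) c) ≡ c
shift-neg (v , v′) (x , y) = ≡.cong₂ _,_ (cancelʳ v x) (cancelʳ v′ y)

neg-shift : ∀ v c → shift (neg v) (shift v c) ≡ c
neg-shift (v , v′) (x , y) = ≡.cong₂ _,_ (cancelˡ v x) (cancelˡ v′ y)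

-- The inverse laws are parameters, instead of `w` being fixed as `neg v`, so that the lemmas also
-- apply with the two cells swapped.
module _ (v w : Cell) (v∘w : ∀ c → shift v (shift w c) ≡ c) (w∘v : ∀ c → shift w (shift v c) ≡ c) where

  ∘-inverse : ∀ (s : CellSet) → s ∘ shift v ∘ shift w ≐ s
  ∘-inverse s = (λ {c} → ≡.subst s (v∘w c)) , (λ {c} → ≡.subst s (≡.sym (v∘w c)))

  ∘-cancel : ∀ {s s′ : CellSet} → s ∘ shift v ≐ s′ ∘ shift v → s ≐ s′
  ∘-cancel {s} {s′} (f , g) =
    ≐-trans (≐-sym (∘-inverse s)) (≐-trans ((λ {c} → f {shift w c}) , (λ {c} → g {shift w c})) (∘-inverse s′))

  tile-∘ : ∀ {s} → IsTile s → IsTile (s ∘ shift v)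
  tile-∘ {s} (shape , u , shape∈ , s⊆ , s⊇) = shape , shift w u , shape∈ , to , from
    where
    to : s ∘ shift v ⊆ translate (shift w u) shape
    to {c} vc∈s with o , o∈ , eq ← ∈-map⁻ (shift u) (s⊆ vc∈s) =
      ≡.subst (_∈ _) (≡.trans (shift-assoc w u o) (≡.trans (≡.cong (shift w) (≡.sym eq)) (w∘v c)))
        (∈-map⁺ (shift (shift w u)) o∈)
    from : translate (shift w u) shape ⊆ s ∘ shift v
    from c∈ with o , o∈ , refl ← ∈-map⁻ (shift (shift w u)) c∈ =
      ≡.subst s (≡.sym (≡.trans (≡.cong (shift v) (shift-assoc w u o)) (v∘w _)))
        (s⊇ (∈-map⁺ (shift u) o∈))

-- The new blocks are the preimages of the old ones under `shift v`. As `Block` is a predicate, a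
-- set is tested by carrying it back along the inverse shift.
pull : ∀ v w → (∀ c → shift v (shift w c) ≡ c) → (∀ c → shift w (shift v c) ≡ c) →
       ∀ {R} → Tiling R → Tiling (R ∘ shift v)
pull v w v∘w w∘v T = record
  { Block    = λ s → Block T (s ∘ shift w)
  ; respects = λ (s⊆s′ , s′⊆s) → respects T ((λ {c} → s⊆s′ {shift w c}) , (λ {c} → s′⊆s {shift w c}))
  ; tiles    = λ {s} s∈T → tile-resp (∘-inverse w v w∘v v∘w s) (tile-∘ v w v∘w w∘v (tiles T s∈T))
  ; inside   = λ {s} s∈T {c} c∈s → inside T s∈T (≡.subst s (≡.sym (w∘v c)) c∈s)
  ; covers   = λ {c} c∈R → let s , s∈T , c∈s = covers T c∈R in
                 s ∘ shift v , respects T (≐-sym (∘-inverse v w v∘w w∘v s)) s∈T , c∈s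
  ; disjoint = λ {s} {s′} s∈T s′∈T (c , c∈s , c∈s′) → ∘-cancel w v w∘v v∘w
                 (disjoint T s∈T s′∈T (shift v c , ≡.subst s (≡.sym (w∘v c)) c∈s
                                                 , ≡.subst s′ (≡.sym (w∘v c)) c∈s′))
  }

count-shift : ∀ {R n} v → Count R n → Count (R ∘ shift v) n
count-shift {R} v = enumeration-image _ _ (pull v w v∘w w∘v)
  (λ (f , g) → (λ {s} → f {s ∘ shift w}) , (λ {s} → g {s ∘ shift w}))
  (λ {T} {T′} (f , g) → (λ {s} → reflect T T′ (λ {s} → f {s}) {s})
                      , (λ {s} → reflect T′ T (λ {s} → g {s}) {s}))
  _
  -- The tiling mapped to `T` is `T` pulled back the other way; its region is `R` only up to `_≐_`,
  -- hence `include`.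
  (λ {T} _ → include (proj₁ (∘-inverse v w v∘w w∘v R)) (proj₂ (∘-inverse v w v∘w w∘v R)) (pull w v w∘v v∘w T)
           , (λ {s} → respects T (≐-sym (∘-inverse w v w∘v v∘w s)))
           , (λ {s} → respects T (∘-inverse w v w∘v v∘w s)))
  where
  w = neg v
  v∘w = shift-neg v
  w∘v = neg-shift v
  reflect : ∀ T T′ → Block (pull v w v∘w w∘v {R} T) ⊆ Block (pull v w v∘w w∘v T′) → Block T ⊆ Block T′
  reflect T T′ T⊆T′ {s} s∈T = respects T′ {s ∘ shift v ∘ shift w} {s} (∘-inverse v w v∘w w∘v s)
    (T⊆T′ {s ∘ shift v} (respects T (≐-sym (∘-inverse v w v∘w w∘v s)) s∈T))

-- The tiles through a given cell.

origin : Cell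
origin = 0ℤ , 0ℤ

rebase : List Cell → Cell → List Cell
rebase shape o = map (shift (neg o)) shape

-- A tile through the origin is a shape with one of its four cells moved there, which gives sixteen
-- tiles.
tilesAtOrigin : List (List Cell)
tilesAtOrigin = concatMap (λ shape → map (rebase shape) shape) shapes

tilesAt : Cell → List (List Cell)
tilesAt c = map (map (shift c)) tilesAtOrigin

shift-origin : ∀ c → shift c origin ≡ c
shift-origin (x , y) = ≡.cong₂ _,_ (ℤ.+-identityʳ x) (ℤ.+-identityʳ y)

map-shift : ∀ u v t → map (shift u) (map (shift v) t) ≡ map (shift (shift u v)) t
map-shift u v t = ≡.trans (≡.sym (List.map-∘ t)) (List.map-cong (≡.sym ∘ shift-assoc u v) t)

tilesAt-sound : ∀ {c t} → t ∈ tilesAt c → IsTile ⟪ t ⟫ × c ∈ t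
tilesAt-sound {c} t∈ with u , u∈ , refl ← ∈-map⁻ (map (shift c)) t∈ = is-tile , c∈
  where
  c∈ = ≡.subst (_∈ map (shift c) u) (shift-origin c)
         (∈-map⁺ (shift c) (All.lookup (from-yes (all? (origin ∈?_) tilesAtOrigin)) u∈))
  is-tile : IsTile ⟪ map (shift c) u ⟫
  is-tile with shape , shape∈ , u∈shape ← find (∈-concatMap⁻ (λ shape → map (rebase shape) shape) {xs = shapes} u∈)
          with o , _ , refl ← ∈-map⁻ (rebase shape) u∈shape =
    shape , shift c (neg o) , shape∈ ,
    (λ {d} → ≡.subst (d ∈_) (map-shift c (neg o) shape)) ,
    (λ {d} → ≡.subst (d ∈_) (≡.sym (map-shift c (neg o) shape)))

tilesAt-complete : ∀ {s c} → IsTile s → s c → ∃[ t ] t ∈ tilesAt c × s ≐ ⟪ t ⟫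
tilesAt-complete {s} {c} (shape , v , shape∈ , s≐) c∈s with o , o∈ , refl ← ∈-map⁻ (shift v) (proj₁ s≐ c∈s) =
  t , ∈-map⁺ (map (shift (shift v o)))
        (∈-concatMap⁺ (λ shape → map (rebase shape) shape) (lose shape∈ (∈-map⁺ (rebase shape) o∈)))
    , (λ {d} → ≡.subst (d ∈_) eq ∘ proj₁ s≐) , (λ {d} → proj₂ s≐ ∘ ≡.subst (d ∈_) (≡.sym eq))
  where
  t = map (shift (shift v o)) (rebase shape o)
  open ≡.≡-Reasoning
  cell-eq : ∀ p → shift v p ≡ shift (shift v o) (shift (neg o) p)
  cell-eq p = begin
    shift v p                              ≡⟨ ≡.cong (shift v) (shift-neg o p) ⟨
    shift v (shift o (shift (neg o) p))    ≡⟨ shift-assoc v o (shift (neg o) p) ⟨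
    shift (shift v o) (shift (neg o) p)    ∎
  eq : map (shift v) shape ≡ t
  eq = ≡.trans (List.map-cong cell-eq shape) (List.map-∘ shape)

-- At the origin, evaluation shows that no tile of the list is contained in a later one; inclusions
-- at `c` shift back to the origin.
tilesAt-distinct : ∀ c → AllPairs (λ t u → ¬ (⟪ t ⟫ ≐ ⟪ u ⟫)) (tilesAt c)
tilesAt-distinct c = AllPairs.map⁺ (AllPairs.map (λ t⊈u (t⊆u , _) → t⊈u (All.tabulate (unshift t⊆u)))
  (from-yes (allPairs? (λ t u → ¬? (all? (_∈? u) t)) tilesAtOrigin)))
  where
  unshift : ∀ {t u} → ⟪ map (shift c) t ⟫ ⊆ ⟪ map (shift c) u ⟫ → ⟪ t ⟫ ⊆ ⟪ u ⟫
  unshift {u = u} t⊆u {d} d∈t with e , e∈u , eq ← ∈-map⁻ (shift c) (t⊆u (∈-map⁺ (shift c) d∈t)) =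
    ≡.subst (_∈ u) (≡.trans (≡.sym (neg-shift c e)) (≡.trans (≡.cong (shift (neg c)) (≡.sym eq)) (neg-shift c d))) e∈u

-- Exhaustive search by the tile through the first cell.

-- `T` is the part of the region that the search never touches, common to all branches. The index
-- keeps only the sum; splitting the list recovers the shares of the branches.
data Total (T : CellSet) : List (List Cell) → ℕ → Set₁ where
  []  : Total T [] 0
  _∷_ : ∀ {L Ls m n} → Count (⟪ L ⟫ ∪ T) m → Total T Ls n → Total T (L ∷ Ls) (m + n)

total-++⁻ : ∀ {T} Ls {Ms n} → Total T (Ls ++ Ms) n →
            ∃[ i ] ∃[ j ] Total T Ls i × Total T Ms j × i + j ≡ n
total-++⁻ []       total       = 0 , _ , [] , total , refl
total-++⁻ (L ∷ Ls) (_∷_ {m = m} c total) with i , j , left , right , eq ← total-++⁻ Ls total =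
  m + i , j , c ∷ left , right , ≡.trans (ℕ.+-assoc m i j) (≡.cong (λ l → m + l) eq)

total-map : ∀ {A : Set} {T} (f : A → List Cell) (n : A → ℕ) → (∀ x → Count (⟪ f x ⟫ ∪ T) (n x)) →
            ∀ xs → Total T (map f xs) (sum (map n xs))
total-map f n count []       = []
total-map f n count (x ∷ xs) = count x ∷ total-map f n count xs

total-[-]⁻ : ∀ {T L n} → Total T (L ∷ []) n → Count (⟪ L ⟫ ∪ T) n
total-[-]⁻ (_∷_ {m = m} c []) = ≡.subst (Count _) (≡.sym (ℕ.+-identityʳ m)) c

-- Two different tiles containing c are never blocks of the same tiling.
count-by-tile : ∀ {R T c} (k : List Cell → List (List Cell)) {ts n} →
  All (λ t → (IsTile ⟪ t ⟫ × c ∈ t) × ⟪ t ⟫ ⊆ R) ts →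
  AllPairs (λ t u → ¬ (⟪ t ⟫ ≐ ⟪ u ⟫)) ts →
  All (λ t → ∀ {m} → Total T (k t) m → Count (R ∖ t) m) ts →
  Total T (concatMap k ts) n →
  Enumeration (Tilings R) (λ τ → Any (λ t → Block τ ⟪ t ⟫) ts) n
count-by-tile k [] [] [] [] = enumeration-∅ _ λ ()
count-by-tile {R} {c = c} k {t ∷ ts} (((t-tile , c∈t) , t⊆R) ∷ tiles) (t≢ts ∷ distinct) (count ∷ counts) total
  with i , j , left , right , refl ← total-++⁻ (k t) total =
  enumeration-resp _ ([ here , there ]′ , λ { (here p) → inj₁ p ; (there p) → inj₂ p })
    (enumeration-∪ _ (λ {_} {τ′} τ≈τ′ t∈τ → exclusive τ′ tiles t≢ts (proj₁ τ≈τ′ t∈τ))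
      (count-with t-tile t⊆R (count left))
      (count-by-tile k tiles distinct counts right))
  where
  exclusive : ∀ (τ : Tiling R) {us} → All (λ t → (IsTile ⟪ t ⟫ × c ∈ t) × ⟪ t ⟫ ⊆ R) us →
              All (λ u → ¬ (⟪ t ⟫ ≐ ⟪ u ⟫)) us → Block τ ⟪ t ⟫ → ¬ Any (λ u → Block τ ⟪ u ⟫) us
  exclusive τ (((_ , c∈u) , _) ∷ _) (t≢u ∷ _)    t∈τ (here u∈τ)   = t≢u (disjoint τ t∈τ u∈τ (c , c∈t , c∈u))
  exclusive τ (_ ∷ tiles)           (_ ∷ t≢us)   t∈τ (there rest) = exclusive τ tiles t≢us t∈τ rest

LeftOf : ℕ → Cell → Set
LeftOf b c = proj₁ c ℤ.< + b

leftOf? : ∀ b c → Dec (LeftOf b c)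
leftOf? b c = proj₁ c ℤ.<? + b

-- Covers the cells of L in order, as long as the tiles at the next cell stay to the left of
-- column b, and lists what remains of L. The fuel k bounds the number of tiles placed.
remainders : (b k : ℕ) → List Cell → List (List Cell)
remainders b zero    L       = L ∷ []
remainders b (suc k) []      = [] ∷ []
remainders b (suc k) (c ∷ L) with all? (all? (leftOf? b)) (tilesAt c)
... | no  _ = (c ∷ L) ∷ []
... | yes _ = concatMap (λ t → remainders b k (filter (_∉? t) (c ∷ L)))
                        (filter (all? (_∈? (c ∷ L))) (tilesAt c))

module _ {b : ℕ} {T : CellSet} (T-right : ∀ {c} → T c → ¬ LeftOf b c) where

  -- A tile to the left of column `b` misses `T`, so removing it only shortens the list.
  ∖-filter : ∀ {L t} → All (LeftOf b) t → (⟪ L ⟫ ∪ T) ∖ t ≐ ⟪ filter (_∉? t) L ⟫ ∪ T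
  ∖-filter {L} {t} t-left =
    (λ { (inj₁ c∈L , c∉t) → inj₁ (∈-filter⁺ (_∉? t) c∈L c∉t) ; (inj₂ c∈T , _) → inj₂ c∈T }) ,
    (λ { (inj₁ c∈) → let c∈L , c∉t = ∈-filter⁻ (_∉? t) c∈ in inj₁ c∈L , c∉t
       ; (inj₂ c∈T) → inj₂ c∈T , λ c∈t → T-right c∈T (All.lookup t-left c∈t) })

  -- Some block covers the first cell `c`, and it is one of `tilesAt c`. The search goes on only if
  -- all of these stay left of column `b`, and then the block cannot reach into `T`, so the
  -- candidates inside the list are exhaustive.
  count-remainders : ∀ k L {n} → Total T (remainders b k L) n → Count (⟪ L ⟫ ∪ T) n
  count-remainders zero    L       total = total-[-]⁻ total
  count-remainders (suc k) []      total = total-[-]⁻ total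
  count-remainders (suc k) (c ∷ L) total with all? (all? (leftOf? b)) (tilesAt c)
  ... | no  _    = total-[-]⁻ total
  ... | yes left = enumeration-resp _ (_ , λ {τ} _ → covering τ)
    (count-by-tile {c = c} (λ t → remainders b k (filter (_∉? t) (c ∷ L)))
      (All.tabulate λ t∈ → let t∈tiles , t⊆L = ∈-filter⁻ inside? t∈ in
         tilesAt-sound t∈tiles , inj₁ ∘ All.lookup t⊆L)
      (AllPairs.filter⁺ inside? (tilesAt-distinct c))
      (All.tabulate λ {t} t∈ total → let t∈tiles , _ = ∈-filter⁻ inside? t∈ in
         count-resp (≐-sym (∖-filter (All.lookup left t∈tiles)))
           (count-remainders k (filter (_∉? t) (c ∷ L)) total))
      total)
    where
    inside? = all? (_∈? (c ∷ L))
    covering : ∀ τ → Any (λ t → Block τ ⟪ t ⟫) (filter inside? (tilesAt c))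
    covering τ with s , s∈τ , c∈s ← covers τ (inj₁ (here refl))
               with t , t∈tiles , s≐t ← tilesAt-complete (tiles τ s∈τ) c∈s =
      lose (∈-filter⁺ inside? t∈tiles (All.tabulate λ d∈t →
             [ id , (λ d∈T → contradiction (All.lookup (All.lookup left t∈tiles) d∈t) (T-right d∈T)) ]′
               (inside τ s∈τ (proj₂ s≐t d∈t))))
           (respects τ s≐t s∈τ)

-- Strips of height five and their columns.

strip : ℕ → ℕ → CellSet
strip a b (x , y) = (+ a ℤ.≤ x × x ℤ.< + b) × (0ℤ ℤ.≤ y × y ℤ.< + 5)

column : ℕ → List Cell
column x = map (λ y → + x , + y) (upTo 5)

columns : ℕ → ℕ → List Cell
columns a zero    = []
columns a (suc k) = column a ++ columns (suc a) k

strip-column : ∀ {a b} → a < b → strip a b ≐ ⟪ column a ⟫ ∪ strip (suc a) b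
strip-column {a} {b} a<b = to , from
  where
  to : strip a b ⊆ ⟪ column a ⟫ ∪ strip (suc a) b
  to {x , y} ((a≤x , x<b) , y-bounds) with + a ℤ.≟ x
  to ((a≤x , x<b) , (ℤ.+≤+ _ , ℤ.+<+ y<5)) | yes refl = inj₁ (∈-map⁺ (λ y → + a , + y) (∈-upTo⁺ y<5))
  to ((a≤x , x<b) , y-bounds)              | no  a≢x  =
    inj₂ ((ℤ.i<j⇒suc[i]≤j (ℤ.≤∧≢⇒< a≤x a≢x) , x<b) , y-bounds)
  from : ⟪ column a ⟫ ∪ strip (suc a) b ⊆ strip a b
  from (inj₁ c∈) with y , y∈ , refl ← ∈-map⁻ (λ y → + a , + y) c∈ =
    (ℤ.≤-refl , ℤ.+<+ a<b) , (ℤ.+≤+ z≤n , ℤ.+<+ (∈-upTo⁻ y∈))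
  from (inj₂ ((a<x , x<b) , y-bounds)) = (ℤ.≤-trans (ℤ.+≤+ (ℕ.n≤1+n a)) a<x , x<b) , y-bounds

⟪++⟫ : ∀ {L M} {T T′ : CellSet} → T ≐ ⟪ M ⟫ ∪ T′ → ⟪ L ⟫ ∪ T ≐ ⟪ L ++ M ⟫ ∪ T′
⟪++⟫ {L} {M} {T} {T′} (T⊆ , T⊇) = [ inj₁ ∘ ∈-++⁺ˡ , Sum.map₁ (∈-++⁺ʳ L) ∘ T⊆ ]′ , from
  where
  from : ⟪ L ++ M ⟫ ∪ T′ ⊆ ⟪ L ⟫ ∪ T
  from (inj₁ c∈)  = Sum.map₂ (T⊇ ∘ inj₁) (∈-++⁻ L c∈)
  from (inj₂ c∈T′) = inj₂ (T⊇ (inj₂ c∈T′))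

-- The search needs a list, but only of the columns it works on; the rest, whose length will depend
-- on `n`, stays a predicate.
strip-columns : ∀ {b} a k → k + a ≤ b → strip a b ≐ ⟪ columns a k ⟫ ∪ strip (k + a) b
strip-columns a zero    _      = inj₂ , λ { (inj₂ c∈) → c∈ }
strip-columns {b} a (suc k) k+a<b =
  ≐-trans (strip-column (ℕ.≤-<-trans (ℕ.m≤n+m a k) k+a<b))
    (⟪++⟫ (≡.subst (λ m → strip (suc a) b ≐ ⟪ columns (suc a) k ⟫ ∪ strip m b) (ℕ.+-suc k a)
      (strip-columns (suc a) k (≡.subst (_≤ b) (≡.sym (ℕ.+-suc k a)) k+a<b))))

strip-shift : ∀ k {a b} → strip a b ∘ shift (neg (+ k , 0ℤ)) ≐ strip (k + a) (k + b)
strip-shift k {a} {b} = to , from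
  where
  to : strip a b ∘ shift (neg (+ k , 0ℤ)) ⊆ strip (k + a) (k + b)
  to {x , y} ((a≤ , <b) , y-bounds) =
    ( ≡.subst (+ (k + a) ℤ.≤_) (cancelʳ (+ k) x) (ℤ.+-monoʳ-≤ (+ k) a≤)
    , ≡.subst (ℤ._< + (k + b)) (cancelʳ (+ k) x) (ℤ.+-monoʳ-< (+ k) <b)) ,
    ≡.subst (λ y → 0ℤ ℤ.≤ y × y ℤ.< + 5) (ℤ.+-identityˡ y) y-bounds
  from : strip (k + a) (k + b) ⊆ strip a b ∘ shift (neg (+ k , 0ℤ))
  from {x , y} ((a≤ , <b) , y-bounds) =
    ( ≡.subst (ℤ._≤ - + k ℤ.+ x) (cancelˡ (+ k) (+ a)) (ℤ.+-monoʳ-≤ (- + k) a≤)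
    , ≡.subst (- + k ℤ.+ x ℤ.<_) (cancelˡ (+ k) (+ b)) (ℤ.+-monoʳ-< (- + k) <b)) ,
    ≡.subst (λ y → 0ℤ ℤ.≤ y × y ℤ.< + 5) (≡.sym (ℤ.+-identityˡ y)) y-bounds

-- Boundary states and the passage across eight columns.

-- Cut the board at a multiple of eight columns from its right end, and cover the cells to the
-- left of the cut in order. A state is the set of cells right of the cut covered by then; they
-- lie in two columns.
data State : Set where
  A B C D E F dead₁ dead₂ dead₃ : State

occupied : State → List Cell
occupied A     = []
occupied B     = (+ 0 , + 1) ∷ (+ 0 , + 2) ∷ (+ 0 , + 3) ∷ (+ 1 , + 1) ∷ []
occupied C     = (+ 0 , + 1) ∷ (+ 0 , + 3) ∷ (+ 0 , + 4) ∷ (+ 1 , + 1) ∷ []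
occupied D     = (+ 0 , + 2) ∷ (+ 0 , + 3) ∷ (+ 0 , + 4) ∷ (+ 1 , + 2) ∷ []
occupied E     = (+ 0 , + 0) ∷ (+ 0 , + 1) ∷ (+ 0 , + 4) ∷ (+ 1 , + 4) ∷ []
occupied F     = (+ 0 , + 0) ∷ (+ 0 , + 1) ∷ (+ 0 , + 3) ∷ (+ 0 , + 4)
               ∷ (+ 1 , + 0) ∷ (+ 1 , + 1) ∷ (+ 1 , + 3) ∷ (+ 1 , + 4) ∷ []
occupied dead₁ = (+ 0 , + 0) ∷ (+ 0 , + 1) ∷ (+ 0 , + 3) ∷ (+ 1 , + 3) ∷ []
occupied dead₂ = (+ 0 , + 0) ∷ (+ 0 , + 1) ∷ (+ 0 , + 2) ∷ (+ 0 , + 3)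
               ∷ (+ 1 , + 0) ∷ (+ 1 , + 1) ∷ (+ 1 , + 2) ∷ (+ 1 , + 3) ∷ []
occupied dead₃ = (+ 0 , + 2) ∷ (+ 0 , + 3) ∷ (+ 0 , + 4) ∷ (+ 1 , + 4) ∷ []

free : State → List Cell
free s = filter (_∉? occupied s) (columns 0 2)

-- The number of completions in a board with eight columns right of the cut.
base : State → ℕ
base A = 2
base B = 1
base C = 1
base E = 1
base F = 1
base _ = 0

-- In the order in which remainders lists them.
next : State → List State
next A = D ∷ A ∷ dead₂ ∷ dead₁ ∷ E ∷ F ∷ A ∷ C ∷ []
next B = F ∷ A ∷ C ∷ []
next C = E ∷ D ∷ A ∷ dead₂ ∷ dead₁ ∷ []
next D = E ∷ []
next E = C ∷ dead₃ ∷ B ∷ A ∷ []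
next F = D ∷ A ∷ dead₂ ∷ dead₁ ∷ []
next _ = []

-- Tiles at a cell of columns 0 to 7 end before column 10, so with this bound the search never stops
-- early, and each tiling leaves one empty list. At most 40 cells, hence ten tiles, are covered,
-- within the fuel 12.
remainders-base : ∀ s → remainders 10 12 (free s ++ columns 2 6) ≡ replicate (base s) []
remainders-base A     = refl
remainders-base B     = refl
remainders-base C     = refl
remainders-base D     = refl
remainders-base E     = refl
remainders-base F     = refl
remainders-base dead₁ = refl
remainders-base dead₂ = refl
remainders-base dead₃ = refl

-- The cells are listed column by column, and column 8 is the first from which some tile reaches
-- column 10. The search therefore stops once columns 0 to 7 are covered, leaving the free cells of
-- a state moved by eight columns. At most 40 + 8 cells are covered, which is the twelve tiles of
-- the fuel.
remainders-next : ∀ s → remainders 10 12 (free s ++ columns 2 8) ≡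
                        map (map (shift (+ 8 , 0ℤ)) ∘ free) (next s)
remainders-next A     = refl
remainders-next B     = refl
remainders-next C     = refl
remainders-next D     = refl
remainders-next E     = refl
remainders-next F     = refl
remainders-next dead₁ = refl
remainders-next dead₂ = refl
remainders-next dead₃ = refl

-- Index `n` stands for 8(n + 1) columns right of the cut, so that the two columns described by the
-- state always exist.
tilings : State → ℕ → ℕ
tilings s zero    = base s
tilings s (suc n) = sum (map (λ t → tilings t n) (next s))

region : State → ℕ → CellSet
region s n = ⟪ free s ⟫ ∪ strip 2 (suc n * 8)

region-shift : ∀ s n → region s n ∘ shift (neg (+ 8 , 0ℤ)) ≐
                       ⟪ map (shift (+ 8 , 0ℤ)) (free s) ⟫ ∪ strip 10 (suc (suc n) * 8)
region-shift s n = Sum.map to (proj₁ (strip-shift 8)) , Sum.map from (proj₂ (strip-shift 8))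
  where
  v = + 8 , 0ℤ
  to : ∀ {c} → shift (neg v) c ∈ free s → c ∈ map (shift v) (free s)
  to {c} c∈ = ≡.subst (_∈ map (shift v) (free s)) (shift-neg v c) (∈-map⁺ (shift v) c∈)
  from : ∀ {c} → c ∈ map (shift v) (free s) → shift (neg v) c ∈ free s
  from c∈ with d , d∈ , refl ← ∈-map⁻ (shift v) c∈ = ≡.subst (_∈ free s) (≡.sym (neg-shift v d)) d∈

-- Induction on the number of eight-column sections: the search clears one section, and each
-- remainder together with the untouched strip is a translate of the region of a next state.
count-region : ∀ n s → Count (region s n) (tilings s n)
count-region zero s =
  count-resp (≐-sym (⟪++⟫ (strip-columns 2 6 ℕ.≤-refl)))
    (count-remainders (λ c∈ → contradiction c∈ empty) 12 (free s ++ columns 2 6)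
      (≡.subst (λ Ls → Total (strip 8 8) Ls (base s)) (≡.sym (remainders-base s)) (all-covered (base s))))
  where
  empty : ∀ {c} → ¬ strip 8 8 c
  empty ((8≤x , x<8) , _) = ℤ.<⇒≱ x<8 8≤x
  all-covered : ∀ m → Total (strip 8 8) (replicate m []) m
  all-covered zero    = []
  all-covered (suc m) = count-∅ (λ { (inj₂ c∈) → empty c∈ }) ∷ all-covered m
count-region (suc n) s =
  count-resp (≐-sym (⟪++⟫ (strip-columns 2 8 (ℕ.+-monoʳ-≤ 8 (s≤s (s≤s z≤n))))))
    (count-remainders (λ ((10≤x , _) , _) x<10 → ℤ.<⇒≱ x<10 10≤x) 12 (free s ++ columns 2 8)
      (≡.subst (λ Ls → Total (strip 10 (suc (suc n) * 8)) Ls (tilings s (suc n))) (≡.sym (remainders-next s))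
        (total-map (map (shift (+ 8 , 0ℤ)) ∘ free) (λ t → tilings t n)
          (λ t → count-resp (region-shift t n) (count-shift (neg (+ 8 , 0ℤ)) (count-region n t)))
          (next s))))

-- The number of tilings of the board.

boardTilings : ℕ → ℕ
boardTilings zero    = 1
boardTilings (suc n) = tilings A n

boardTilings-cardinality : ∀ n → HasCardinality (Tilings (Board 5 (8 * n))) (boardTilings n)
boardTilings-cardinality n = enumeration⇒cardinality _
  (≡.subst (λ w → Count (Board 5 w) (boardTilings n)) (ℕ.*-comm n 8) (count n))
  where
  count : ∀ n → Count (Board 5 (n * 8)) (boardTilings n)
  count zero    = count-∅ λ ((0≤x , x<0) , _) → ℤ.<⇒≱ x<0 0≤x
  -- Nothing is occupied in state `A`, so `free A` is `columns 0 2` and the region is the whole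
  -- board.
  count (suc n) = count-resp (≐-sym (strip-columns 0 2 (s≤s (s≤s z≤n)))) (count-region n A)

-- Elimination in the linear system.

-- The successors of `A` are those of `B` and of `C` together, up to order. This removes `B` from
-- the system in `E-suc`.
A-split : ∀ n → tilings A n ≡ tilings B n + tilings C n
A-split zero    = refl
A-split (suc n) = lemma (tilings A n) (tilings C n) (tilings D n) (tilings E n) (tilings F n)
                        (tilings dead₁ n) (tilings dead₂ n)
  where
  lemma : ∀ a c d e f x y → d + (a + (y + (x + (e + (f + (a + (c + 0))))))) ≡
                            f + (a + (c + 0)) + (e + (d + (a + (y + (x + 0)))))
  lemma = solve-∀

dead₁-zero : ∀ n → tilings dead₁ n ≡ 0
dead₁-zero zero    = refl
dead₁-zero (suc _) = refl

dead₂-zero : ∀ n → tilings dead₂ n ≡ 0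
dead₂-zero zero    = refl
dead₂-zero (suc _) = refl

dead₃-zero : ∀ n → tilings dead₃ n ≡ 0
dead₃-zero zero    = refl
dead₃-zero (suc _) = refl

A-suc : ∀ n → tilings A (suc n) ≡ 2 * tilings A n + tilings C n + tilings D n + tilings E n + tilings F n
A-suc n rewrite dead₁-zero n | dead₂-zero n =
  lemma (tilings A n) (tilings C n) (tilings D n) (tilings E n) (tilings F n)
  where
  lemma : ∀ a c d e f → d + (a + (e + (f + (a + (c + 0))))) ≡ 2 * a + c + d + e + f
  lemma = solve-∀

C-suc : ∀ n → tilings C (suc n) ≡ tilings A n + tilings D n + tilings E n
C-suc n rewrite dead₁-zero n | dead₂-zero n = lemma (tilings A n) (tilings D n) (tilings E n)
  where
  lemma : ∀ a d e → e + (d + (a + 0)) ≡ a + d + e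
  lemma = solve-∀

D-suc : ∀ n → tilings D (suc n) ≡ tilings E n
D-suc n = ℕ.+-identityʳ (tilings E n)

E-suc : ∀ n → tilings E (suc n) ≡ 2 * tilings A n
E-suc n rewrite dead₃-zero n | A-split n = lemma (tilings B n) (tilings C n)
  where
  lemma : ∀ b c → c + (b + (b + c + 0)) ≡ 2 * (b + c)
  lemma = solve-∀

F-suc : ∀ n → tilings F (suc n) ≡ tilings A n + tilings D n
F-suc n rewrite dead₁-zero n | dead₂-zero n = lemma (tilings A n) (tilings D n)
  where
  lemma : ∀ a d → d + (a + 0) ≡ a + d
  lemma = solve-∀

-- Going back in `n`, `E` is twice an earlier `A`, `D` an earlier `E`, and `C` and `F` are sums of
-- earlier `A`, `D` and `E`. Substituting these in `A-suc` reaches back four terms of `A`.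
A-recurrence : ∀ n → tilings A (4 + n) ≡
  2 * tilings A (3 + n) + 4 * tilings A (2 + n) + 4 * tilings A (1 + n) + 4 * tilings A n
A-recurrence = solve-system (tilings A) (tilings C) (tilings D) (tilings E) (tilings F) A-suc C-suc D-suc E-suc F-suc
  where
  collect : ∀ a₃ a₂ a₁ a₀ →
    2 * a₃ + (a₂ + 2 * a₀ + 2 * a₁) + 2 * a₁ + 2 * a₂ + (a₂ + 2 * a₀) ≡ 2 * a₃ + 4 * a₂ + 4 * a₁ + 4 * a₀
  collect = solve-∀
  -- For abstract sequences the equations act as plain rewrite rules, whereas `tilings s (suc n)`
  -- would unfold to its sum.
  solve-system : (a c d e f : ℕ → ℕ) →
    (∀ n → a (suc n) ≡ 2 * a n + c n + d n + e n + f n) → (∀ n → c (suc n) ≡ a n + d n + e n) →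
    (∀ n → d (suc n) ≡ e n) → (∀ n → e (suc n) ≡ 2 * a n) → (∀ n → f (suc n) ≡ a n + d n) →
    ∀ n → a (4 + n) ≡ 2 * a (3 + n) + 4 * a (2 + n) + 4 * a (1 + n) + 4 * a n
  solve-system a c d e f a-suc c-suc d-suc e-suc f-suc n
    rewrite a-suc (3 + n) | c-suc (2 + n) | f-suc (2 + n) | d-suc (2 + n) | d-suc (1 + n)
          | e-suc (2 + n) | e-suc (1 + n) | e-suc n
    = collect (a (3 + n)) (a (2 + n)) (a (1 + n)) (a n)

-- The generating function as a quotient.

fromℕ : ℕ → ℚ
fromℕ n = + n / 1

module _ where
  open ℚᵘ.≃-Reasoning

  private
    unnormalise : ∀ n → ℚ.toℚᵘ (fromℕ n) ℚᵘ.≃ ℚᵘ.mkℚᵘ (+ n) 0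
    unnormalise n = ℚ.toℚᵘ-fromℚᵘ (ℚᵘ.mkℚᵘ (+ n) 0)

  -- Rationals are stored in lowest terms, so the identity is checked on unnormalised fractions with
  -- denominator 1, where it is integer arithmetic.
  fromℕ-+ : ∀ m n → fromℕ (m + n) ≡ fromℕ m +ℚ fromℕ n
  fromℕ-+ m n = ℚ.toℚᵘ-injective (begin
    ℚ.toℚᵘ (fromℕ (m + n))                      ≈⟨ unnormalise (m + n) ⟩
    ℚᵘ.mkℚᵘ (+ (m + n)) 0                       ≈⟨ ℚᵘ.*≡* (≡.cong (ℤ._* + 1) pos-+) ⟩
    ℚᵘ.mkℚᵘ (+ m) 0 ℚᵘ.+ ℚᵘ.mkℚᵘ (+ n) 0        ≈⟨ ℚᵘ.+-cong (unnormalise m) (unnormalise n) ⟨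
    ℚ.toℚᵘ (fromℕ m) ℚᵘ.+ ℚ.toℚᵘ (fromℕ n)      ≈⟨ ℚ.toℚᵘ-homo-+ (fromℕ m) (fromℕ n) ⟨
    ℚ.toℚᵘ (fromℕ m +ℚ fromℕ n)                 ∎)
    where
    pos-+ : + (m + n) ≡ + m ℤ.* + 1 ℤ.+ + n ℤ.* + 1
    pos-+ = ≡.sym (≡.cong₂ ℤ._+_ (ℤ.*-identityʳ (+ m)) (ℤ.*-identityʳ (+ n)))

  fromℕ-* : ∀ m n → fromℕ (m * n) ≡ fromℕ m *ℚ fromℕ n
  fromℕ-* m n = ℚ.toℚᵘ-injective (begin
    ℚ.toℚᵘ (fromℕ (m * n))                      ≈⟨ unnormalise (m * n) ⟩
    ℚᵘ.mkℚᵘ (+ (m * n)) 0                       ≈⟨ ℚᵘ.*≡* (≡.cong (ℤ._* + 1) (ℤ.pos-* m n)) ⟩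
    ℚᵘ.mkℚᵘ (+ m) 0 ℚᵘ.* ℚᵘ.mkℚᵘ (+ n) 0        ≈⟨ ℚᵘ.*-cong (unnormalise m) (unnormalise n) ⟨
    ℚ.toℚᵘ (fromℕ m) ℚᵘ.* ℚ.toℚᵘ (fromℕ n)      ≈⟨ ℚ.toℚᵘ-homo-* (fromℕ m) (fromℕ n) ⟨
    ℚ.toℚᵘ (fromℕ m *ℚ fromℕ n)                ∎)

Recurrent : PowerSeries → Set
Recurrent q = ∀ n → q (4 + n) ≡
  fromℕ 2 *ℚ q (3 + n) +ℚ fromℕ 4 *ℚ q (2 + n) +ℚ fromℕ 4 *ℚ q (1 + n) +ℚ fromℕ 4 *ℚ q n

-- The hypotheses on f say that f is the product of q and the denominator.
⊘-denominator : ∀ q f → Recurrent q →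
  f 0 ≡ -ℚ q 0 →
  f 1 ≡ fromℕ 2 *ℚ q 0 -ℚ q 1 →
  f 2 ≡ fromℕ 4 *ℚ q 0 +ℚ fromℕ 2 *ℚ q 1 -ℚ q 2 →
  f 3 ≡ fromℕ 4 *ℚ q 0 +ℚ fromℕ 4 *ℚ q 1 +ℚ fromℕ 2 *ℚ q 2 -ℚ q 3 →
  (∀ n → f (4 + n) ≡ 0ℚ) →
  f ⊘ denominator ≗ q
⊘-denominator q f rec f₀ f₁ f₂ f₃ f₄ = λ { zero → quotient ; (suc n) → shifted n }
  where
  open +-*-Solver
  quotient : f 0 ℚ.÷ denominator 0 ≡ q 0
  quotient rewrite f₀ = solve 1 (λ x → :- x :* con (ℤ.-1ℤ / 1) := x) refl (q 0)
  shifted : ∀ n → (f ⊘ denominator) (suc n) ≡ q (suc n)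
  -- One step of long division produces `q 0` and leaves a remainder that is the product of `tail q`
  -- and the denominator, so the same hypotheses hold again.
  shifted = ⊘-denominator (tail q) (λ m → f (suc m) -ℚ (f 0 ℚ.÷ denominator 0) *ℚ denominator (suc m))
    (λ n → rec (suc n)) r₀ r₁ r₂ r₃ r₄
    where
    r₀ : f 1 -ℚ (f 0 ℚ.÷ denominator 0) *ℚ fromℕ 2 ≡ -ℚ q 1
    r₀ rewrite quotient | f₁ =
      solve 2 (λ x y → con (fromℕ 2) :* x :- y :- x :* con (fromℕ 2) := :- y) refl (q 0) (q 1)
    r₁ : f 2 -ℚ (f 0 ℚ.÷ denominator 0) *ℚ fromℕ 4 ≡ fromℕ 2 *ℚ q 1 -ℚ q 2
    r₁ rewrite quotient | f₂ =
      solve 3 (λ x y z → con (fromℕ 4) :* x :+ con (fromℕ 2) :* y :- z :- x :* con (fromℕ 4) :=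
                         con (fromℕ 2) :* y :- z) refl (q 0) (q 1) (q 2)
    r₂ : f 3 -ℚ (f 0 ℚ.÷ denominator 0) *ℚ fromℕ 4 ≡ fromℕ 4 *ℚ q 1 +ℚ fromℕ 2 *ℚ q 2 -ℚ q 3
    r₂ rewrite quotient | f₃ =
      solve 4 (λ x y z w → con (fromℕ 4) :* x :+ con (fromℕ 4) :* y :+ con (fromℕ 2) :* z :- w :- x :* con (fromℕ 4) :=
                           con (fromℕ 4) :* y :+ con (fromℕ 2) :* z :- w) refl (q 0) (q 1) (q 2) (q 3)
    r₃ : f 4 -ℚ (f 0 ℚ.÷ denominator 0) *ℚ fromℕ 4 ≡
         fromℕ 4 *ℚ q 1 +ℚ fromℕ 4 *ℚ q 2 +ℚ fromℕ 2 *ℚ q 3 -ℚ q 4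
    -- Here alone the recurrence enters: it supplies `q 4`, and the vanishing coefficient `f 4`
    -- keeps the remainder of degree at most 3.
    r₃ rewrite quotient | f₄ 0 | rec 0 =
      solve 4 (λ x y z w → con 0ℚ :- x :* con (fromℕ 4) :=
                 con (fromℕ 4) :* y :+ con (fromℕ 4) :* z :+ con (fromℕ 2) :* w :-
                 (con (fromℕ 2) :* w :+ con (fromℕ 4) :* z :+ con (fromℕ 4) :* y :+ con (fromℕ 4) :* x))
        refl (q 0) (q 1) (q 2) (q 3)
    r₄ : ∀ n → f (5 + n) -ℚ (f 0 ℚ.÷ denominator 0) *ℚ 0ℚ ≡ 0ℚ
    r₄ n rewrite f₄ (1 + n) = solve 1 (λ x → con 0ℚ :- x :* con 0ℚ := con 0ℚ) refl (f 0 ℚ.÷ denominator 0)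

-- The recurrence starts only at the tail: from 1, 2, 7, 24 it would give 88 instead of 86.
tail-recurrent : Recurrent (tail (generatingFunction boardTilings))
tail-recurrent n = begin
  fromℕ (tilings A (4 + n))
    ≡⟨ ≡.cong fromℕ (A-recurrence n) ⟩
  fromℕ (2 * x + 4 * y + 4 * z + 4 * w)
    ≡⟨ fromℕ-+ (2 * x + 4 * y + 4 * z) (4 * w) ⟩
  fromℕ (2 * x + 4 * y + 4 * z) +ℚ fromℕ (4 * w)
    ≡⟨ ≡.cong (_+ℚ fromℕ (4 * w)) (fromℕ-+ (2 * x + 4 * y) (4 * z)) ⟩
  fromℕ (2 * x + 4 * y) +ℚ fromℕ (4 * z) +ℚ fromℕ (4 * w)
    ≡⟨ ≡.cong (λ p → p +ℚ fromℕ (4 * z) +ℚ fromℕ (4 * w)) (fromℕ-+ (2 * x) (4 * y)) ⟩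
  fromℕ (2 * x) +ℚ fromℕ (4 * y) +ℚ fromℕ (4 * z) +ℚ fromℕ (4 * w)
    ≡⟨ ≡.cong₂ _+ℚ_ (≡.cong₂ _+ℚ_ (≡.cong₂ _+ℚ_ (fromℕ-* 2 x) (fromℕ-* 4 y)) (fromℕ-* 4 z)) (fromℕ-* 4 w) ⟩
  fromℕ 2 *ℚ fromℕ x +ℚ fromℕ 4 *ℚ fromℕ y +ℚ fromℕ 4 *ℚ fromℕ z +ℚ fromℕ 4 *ℚ fromℕ w ∎
  where
  open ≡.≡-Reasoning
  x = tilings A (3 + n)
  y = tilings A (2 + n)
  z = tilings A (1 + n)
  w = tilings A n

generatingFunction-quotient : generatingFunction boardTilings ≗ numerator ⊘ denominator
generatingFunction-quotient zero    = refl
-- The first division step has quotient 1 and leaves coefficients -2, -3, -2, -2, which is the tail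
-- times the denominator; evaluation checks this.
generatingFunction-quotient (suc n) = ≡.sym
  (⊘-denominator (tail (generatingFunction boardTilings)) _ tail-recurrent refl refl refl refl (λ _ → refl) n)

proposition3 : ∃[ a ]
    (∀ n → HasCardinality (Tilings (Board 5 (8 * n))) (a n))
    × generatingFunction a ≗ numerator ⊘ denominator
    × (∀ n → n ≥ 5 →
    a n ≡ 2 * a (n ∸ 1) + 4 * a (n ∸ 2) + 4 * a (n ∸ 3) + 4 * a (n ∸ 4))
    × (a 0 ≡ 1 × a 1 ≡ 2 × a 2 ≡ 7 × a 3 ≡ 24 × a 4 ≡ 86)
    × map a (upTo 8) ≡ 1 ∷ 2 ∷ 7 ∷ 24 ∷ 86 ∷ 304 ∷ 1076 ∷ 3808 ∷ []
proposition3 =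
  boardTilings ,
  boardTilings-cardinality ,
  generatingFunction-quotient ,
  -- With n = 5 + m all five terms belong to the tail, where `boardTilings (suc k)` is
  -- `tilings A k`.
  (λ { _ (s≤s (s≤s (s≤s (s≤s (s≤s {n = m} _))))) → A-recurrence m }) ,
  (refl , refl , refl , refl , refl) ,
  refl
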